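{- Assume $(\omega, \mathcal{F})$ is a nondegenerate Ramsey algebra and $\mathcal{F}$ is countable. Suppose $S_n$ is a countable collection of subsets of $\omega^n$ for every $n \geq 1$. Then there exists an admissible $\mathfrak{A}=\{ \mathcal{A}_n \}_{n\geq 1}$ such that (1) $\mathcal{A}_n$ is a countable superset of $S_n$ for every $n \geq 1$; (2) every operation in $\mathcal{F}$ is an $\mathfrak{A}$-operation; (3) there exists a nonprincipal $\mathfrak{A}$-ultrafilter $U$ that is strongly reductible for $\mathcal{F}$.
   Context: $\omega=\{0,1,2,\dots\}$; tuples are identified so that $\omega^{n}=\omega^{n-1}\times\omega$ and the 1-tuple $(x)$ is $x$. A field of sets over a set $S$ is a nonempty collection of subsets of $S$ closed under finite unions, finite intersections and complementation relative to $S$; by convention every field of sets is assumed to contain all singletons. An ultrafilter on a field of sets $\mathcal{A}$ over $S$ is a subset $U\subseteq\mathcal{A}$ closed under (finite) intersections with $S\in U$, $\emptyset\notin U$, and for every $X\in\mathcal{A}$ either $X\in U$ or $S\setminus X\in U$. It is principal if it equals $\{X\in\mathcal{A}\mid a\in X\}$ for some $a\in S$, and nonprincipal otherwise. Algebras and reductions. An algebra $(A,\mathcal{F})$ is a nonempty set $A$ with a collection $\mathcal{F}$ of operations on $A$ (each of some finite arity $\geq 1$). An operation $f$ is an orderly composition of a collection $\mathcal{G}$ of operations if there are $g,h_1,\dots,h_n\in\mathcal{G}$ with $f(\bar x_1,\dots,\bar x_n)=g(h_1(\bar x_1),\dots,h_n(\bar x_n))$, where $\bar x_1,\dots,\bar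 x_n$ are consecutive disjoint lists of variables of the appropriate lengths. The collection of orderly terms over $\mathcal{F}$ is the smallest collection of operations on $A$ that includes $\mathcal{F}$, contains the identity function on $A$, and is closed under orderly composition. For infinite sequences $\vec a,\vec b$ in $A$, $\vec a\leq_{\mathcal{F}}\vec b$ means that there are finite sequences $\vec b_n$ and orderly terms $f_n$ over $\mathcal{F}$ ($n\in\omega$) such that the concatenation $\vec b_0*\vec b_1*\vec b_2*\cdots$ is a subsequence of $\vec b$ and $\vec a(n)=f_n(\vec b_n)$ for all $n$ (the length of $\vec b_n$ being the arity of $f_n$). $\mathrm{FR}_{\mathcal{F}}(\vec b)$ is the set of all $f(\vec b_0)$ with $f$ an orderly term over $\mathcal{F}$ and $\vec b_0$ a finite subsequence of $\vec b$ of length the arity of $f$. $\vec a-i$ denotes the sequence $\langle \vec a(i),\vec a(i+1),\dots\rangle$. $(A,\mathcal{F})$ is a Ramsey algebra if for every infinite sequence $\vec a$ in $A$ and every $X\subseteq A$ there is $\vec b\leq_{\mathcal{F}}\vec a$ such that $\mathrm{FR}_{\mathcal{F}}(\vec b)$ is contained in or disjoint from $X$. It is a degenerate Ramsey algebra if for every infinite sequence $\vec a$ in $A$ there is $\vec b\leq_{\mathcal{F}}\vec a$ with $|\mathrm{FR}_{\mathcal{F}}(\vec b)|=1$; a nondegenerate Ramsey algebra is a Ramsey algebra that is not degenerate. Admissibility. $\mathfrak{A}=\{\mathcal{A}_n\}_{n\geq1}$, where each $\mathcal{A}_n$ is a field of sets over $\omega^n$, is admissible if for every $n\geq 2$ and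 $X\in\mathcal{A}_n$: (i) $\{(a_2,\dots,a_n,a_1)\mid(a_1,\dots,a_n)\in X\}\in\mathcal{A}_n$; and (ii) for all $a_1\in\omega$, $\{(a_2,\dots,a_n)\mid(a_1,\dots,a_n)\in X\}\in\mathcal{A}_{n-1}$. For admissible $\mathfrak{A}$, an $\mathfrak{A}$-ultrafilter is an ultrafilter $U$ on $\mathcal{A}_1$ such that for every $n\geq1$ and $X\in\mathcal{A}_{n+1}$, $\{(a_1,\dots,a_n)\in\omega^n\mid\{a_{n+1}\in\omega\mid(a_1,\dots,a_{n+1})\in X\}\in U\}\in\mathcal{A}_n$. An $m$-ary operation $f$ on $\omega$ is an $\mathfrak{A}$-operation if for every $n\geq1$ and $X\in\mathcal{A}_n$, $\{(a_1,\dots,a_{n+m-1})\mid(a_1,\dots,a_{n-1},f(a_n,\dots,a_{n+m-1}))\in X\}\in\mathcal{A}_{n+m-1}$. An ultrafilter $U$ on a field of sets over $\omega$ is strongly reductible for $\mathcal{F}$ if for every $X\in U$ there is an infinite sequence $\vec a$ in $\omega$ such that $\mathrm{FR}_{\mathcal{F}}(\vec a)\subseteq X$ and $\mathrm{FR}_{\mathcal{F}}(\vec a-i)\in U$ for all $i\in\omega$. -}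

module Defs where

open import Data.Fin.Base using (Fin; zero; suc; toℕ) renaming (_<_ to _<ᶠ_)
open import Data.Nat.Base using (ℕ; zero; suc; _+_; _<_)
open import Data.Product.Base using (Σ; ∃; ∃-syntax; _×_; _,_; proj₁)
open import Data.Sum.Base using (_⊎_)
open import Data.Vec.Base using (Vec; []; _∷_; _∷ʳ_; head; init; last; lookup; sum; tabulate; take; drop)
open import Function.Base using (_∘_)
open import Function.Bundles using (Injection)
open import Level using (0ℓ; _⊔_)
open import Relation.Binary.Bundles using (Setoid)
import Relation.Binary.Construct.On as On
open import Relation.Binary.Core using (_Preserves_⟶_)
open import Relation.Binary.PropositionalEquality using (_≡_; _≗_; refl; sym; trans; setoid)
open import Relation.Nullary.Negation using (¬_)
open import Relation.Unary using (Pred; _∈_; _∉_; _⊆_; _≐_; _∪_; _∩_; ∁; ∅; ｛_｝; _⊥_; _⊢_; Satisfiable)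
  renaming (U to full)
open import Relation.Unary.Relation.Binary.Equality using (≐-setoid)

-- P is the subset of the setoid S it picks out, its elements being
-- identified when they are equal in S.
Countable : ∀ {c ℓ p} (S : Setoid c ℓ) → Pred (Setoid.Carrier S) p → Set (c ⊔ ℓ ⊔ p)
Countable S P = Injection (On.setoid S (proj₁ {B = P})) (setoid ℕ)

Collection : Set → Set₁
Collection S = Pred (Pred S 0ℓ) 0ℓ

CountableCollection : {S : Set} → Collection S → Set₁
CountableCollection {S} = Countable (≐-setoid S 0ℓ)

Op : Set → ℕ → Set
Op A m = Vec A m → A

-- (k , f) is an operation f of arity k + 1, so that arities are ≥ 1.
Operation : Set → Set
Operation A = Σ ℕ λ k → Op A (suc k)

data _≈ₒ_ {A : Set} : Operation A → Operation A → Set where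
  pointwise : ∀ {k} {f g : Op A (suc k)} → f ≗ g → (k , f) ≈ₒ (k , g)

operationSetoid : Set → Setoid 0ℓ 0ℓ
operationSetoid A = record
  { Carrier       = Operation A
  ; _≈_           = _≈ₒ_
  ; isEquivalence = record
    { refl  = pointwise λ _ → refl
    ; sym   = λ { (pointwise p) → pointwise λ xs → sym (p xs) }
    ; trans = λ { (pointwise p) (pointwise q) → pointwise λ xs → trans (p xs) (q xs) }
    }
  }

Operations : Set → Set₁
Operations A = Pred (Operation A) 0ℓ

-- The i-th of the consecutive blocks, of lengths ms, into which a tuple
-- is cut.
block : ∀ {A : Set} {n} (ms : Vec ℕ n) → Vec A (sum ms) → (i : Fin n) → Vec A (lookup ms i)
block (m ∷ ms) xs zero    = take m xs
block (m ∷ ms) xs (suc i) = block ms (drop m xs) i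

orderlyComposition : ∀ {A : Set} {n} {ms : Vec ℕ n} →
                     Op A n → ((i : Fin n) → Op A (lookup ms i)) → Op A (sum ms)
orderlyComposition {ms = ms} g hs xs = g (tabulate λ i → hs i (block ms xs i))

data OrderlyTerm {A : Set} (F : Operations A) : ∀ {m} → Op A m → Set where
  basic    : ∀ {k f} → (k , f) ∈ F → OrderlyTerm F f
  identity : OrderlyTerm F {1} head
  compose  : ∀ {n} {ms : Vec ℕ n} {g : Op A n} {hs : (i : Fin n) → Op A (lookup ms i)} →
             OrderlyTerm F g → (∀ i → OrderlyTerm F (hs i)) →
             OrderlyTerm F (orderlyComposition {ms = ms} g hs)

Seq : Set → Set
Seq A = ℕ → A

-- The sequence denoted a − i, that is ⟨a i, a (i + 1), …⟩.
dropSeq : ∀ {A : Set} → ℕ → Seq A → Seq A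
dropSeq i a n = a (i + n)

_⊑_ : ∀ {A : Set} → Seq A → Seq A → Set
c ⊑ b = ∃[ φ ] φ Preserves _<_ ⟶ _<_ × c ≗ b ∘ φ

_⊑ᶠ_ : ∀ {A : Set} {m} → Vec A m → Seq A → Set
xs ⊑ᶠ b = ∃[ φ ] φ Preserves _<ᶠ_ ⟶ _<_ × lookup xs ≗ b ∘ φ

offset : (ℕ → ℕ) → ℕ → ℕ
offset k zero    = 0
offset k (suc n) = offset k n + k n

-- c = bs 0 * bs 1 * bs 2 * ⋯ ; this determines c as soon as infinitely
-- many of the lengths k n are nonzero.
IsConcatenation : ∀ {A : Set} {k : ℕ → ℕ} → (∀ n → Vec A (k n)) → Seq A → Set
IsConcatenation {k = k} bs c = ∀ n (j : Fin (k n)) → c (offset k n + toℕ j) ≡ lookup (bs n) j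

record _≤[_]_ {A : Set} (a : Seq A) (F : Operations A) (b : Seq A) : Set where
  field
    arity         : ℕ → ℕ
    pieces        : ∀ n → Vec A (arity n)
    terms         : ∀ n → Op A (arity n)
    concatenation : Seq A
    orderly       : ∀ n → OrderlyTerm F (terms n)
    isConcat      : IsConcatenation pieces concatenation
    subsequence   : concatenation ⊑ b
    value         : ∀ n → a n ≡ terms n (pieces n)

FR : ∀ {A : Set} → Operations A → Seq A → Pred A 0ℓ
FR {A} F b x = ∃[ m ] Σ (Op A m) λ f → Σ (Vec A m) λ xs →
  OrderlyTerm F f × xs ⊑ᶠ b × x ≡ f xs

IsRamsey : (A : Set) → Operations A → Set₁
IsRamsey A F = ∀ (a : Seq A) (X : Pred A 0ℓ) →
  ∃[ b ] b ≤[ F ] a × (FR F b ⊆ X ⊎ FR F b ⊥ X)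

IsDegenerateRamsey : (A : Set) → Operations A → Set
IsDegenerateRamsey A F = ∀ (a : Seq A) →
  ∃[ b ] b ≤[ F ] a × (∃[ x ] FR F b ≐ ｛ x ｝)

IsNondegenerateRamsey : (A : Set) → Operations A → Set₁
IsNondegenerateRamsey A F = IsRamsey A F × ¬ IsDegenerateRamsey A F

-- Predicates stand for sets, so collections of them have to be closed
-- under extensional equality: this is the purpose of both `resp` fields
-- below.
record IsField {S : Set} (𝒜 : Collection S) : Set₁ where
  field
    resp       : ∀ {X Y} → X ≐ Y → X ∈ 𝒜 → Y ∈ 𝒜
    nonempty   : Satisfiable 𝒜
    union      : ∀ {X Y} → X ∈ 𝒜 → Y ∈ 𝒜 → (X ∪ Y) ∈ 𝒜
    inter      : ∀ {X Y} → X ∈ 𝒜 → Y ∈ 𝒜 → (X ∩ Y) ∈ 𝒜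
    compl      : ∀ {X} → X ∈ 𝒜 → ∁ X ∈ 𝒜
    singletons : ∀ a → ｛ a ｝ ∈ 𝒜

record IsUltrafilter {S : Set} (𝒜 : Collection S) (U : Collection S) : Set₁ where
  field
    resp   : ∀ {X Y} → X ≐ Y → X ∈ U → Y ∈ U
    subset : U ⊆ 𝒜
    inter  : ∀ {X Y} → X ∈ U → Y ∈ U → (X ∩ Y) ∈ U
    whole  : full ∈ U
    proper : ∅ ∉ U
    ultra  : ∀ {X} → X ∈ 𝒜 → X ∈ U ⊎ ∁ X ∈ U

IsPrincipal : {S : Set} → Collection S → Collection S → Set₁
IsPrincipal 𝒜 U = ∃[ a ] U ≐ (λ X → X ∈ 𝒜 × a ∈ X)

StronglyReductible : Operations ℕ → Collection ℕ → Set₁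
StronglyReductible F U = ∀ {X} → X ∈ U →
  Σ (Seq ℕ) λ a → FR F a ⊆ X × (∀ i → FR F (dropSeq i a) ∈ U)

-- A family has a member for every n, but only those with n ≥ 1 carry
-- meaning: every condition on a family below ignores its member at 0.
Family : Set₁
Family = (n : ℕ) → Collection (Vec ℕ n)

record IsAdmissible (𝔄 : Family) : Set₁ where
  field
    isField : ∀ n → IsField (𝔄 (suc n))
    rotate  : ∀ n {X} → X ∈ 𝔄 (2 + n) → (λ v → (last v ∷ init v) ∈ X) ∈ 𝔄 (2 + n)
    section : ∀ n {X} → X ∈ 𝔄 (2 + n) → ∀ a → (λ v → (a ∷ v) ∈ X) ∈ 𝔄 (suc n)

-- The first member of a family as a collection of subsets of ω, through
-- the identification of (x) with x.
unary : Family → Collection ℕ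
unary 𝔄 X = (head ⊢ X) ∈ 𝔄 1

record Is[_]-Ultrafilter (𝔄 : Family) (U : Collection ℕ) : Set₁ where
  field
    isUltrafilter : IsUltrafilter (unary 𝔄) U
    definable     : ∀ n {X} → X ∈ 𝔄 (2 + n) →
                    (λ (v : Vec ℕ (suc n)) → (λ a → (v ∷ʳ a) ∈ X) ∈ U) ∈ 𝔄 (suc n)

-- With n = p + 1, the arity n + m − 1 is p + m.
Is[_]-Operation : Family → ∀ {m} → Op ℕ m → Set₁
Is[ 𝔄 ]-Operation {m} f = ∀ p {X} → X ∈ 𝔄 (suc p) →
  (λ (v : Vec ℕ (p + m)) → (take p v ∷ʳ f (drop p v)) ∈ X) ∈ 𝔄 (p + m)

{-# OPTIONS --safe #-}
-- Build in turn countable presentations e 0, e 1, … of families of sets and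
-- sequences b 0, b 1, … , where b r is a reduction of b (r − 1) such that
-- every one-dimensional section of a set listed by e r contains, or is
-- disjoint from, FR (b r − j) for some j: apply the Ramsey property
-- countably often and diagonalise. The sets FR (b r − j) then generate an
-- ultrafilter on the sets listed by e r, which later stages cannot change, so
-- the next presentation can be closed under the quantifier of this
-- ultrafilter, along with one application of every other operation required.
-- Listing also the sets FR (b r − j) at stage r + 1 gives strong
-- reducibility, and starting below a sequence that witnesses nondegeneracy
-- keeps the ultrafilter nonprincipal. Excluded middle, being untruncated,
-- supplies the choices.
module Submission where

open import Defs
open import Axiom.ExcludedMiddle using (ExcludedMiddle)
open import Data.Empty using (⊥-elim)
open import Data.Fin.Base using (Fin; zero; suc; toℕ) renaming (_<_ to _<ᶠ_)
open import Data.Nat.Base using (ℕ; zero; suc; _+_; _∸_; _⊔_; _≤_; _<_; z≤n; s≤s; s≤s⁻¹; s<s⁻¹)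
open import Data.Nat.Properties
open import Data.Product.Base as Product using (Σ; ∃; ∃-syntax; _×_; _,_; proj₁; proj₂)
open import Data.Sum.Base as Sum using (_⊎_; inj₁; inj₂)
open import Data.Unit.Base using (tt)
open import Data.Vec.Base
  using (Vec; []; _∷_; _∷ʳ_; _++_; head; tail; init; last; lookup; map; sum; tabulate; take; drop)
open import Data.Vec.Properties using (lookup-map; map-++; ++-injective; take++drop≡id)
open import Function.Base using (_∘_; id)
open import Function.Bundles using (Injection)
open import Level using (0ℓ; Lift; lift; lower) renaming (suc to lsuc; _⊔_ to _⊔ₗ_)
open import Relation.Binary.Bundles using (Setoid)
open import Relation.Binary.Core using (_Preserves_⟶_)
open import Relation.Binary.PropositionalEquality
  using (_≡_; _≗_; refl; sym; trans; cong; cong₂; subst; module ≡-Reasoning)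
open import Relation.Nullary.Decidable using (Dec; yes; no; map′; decidable-stable)
open import Relation.Nullary.Negation using (¬_)
open import Relation.Unary using (Pred; _∈_; _⊆_; _≐_; _∪_; _∩_; ∁; ｛_｝; _⊢_)
  renaming (U to full)
open import Relation.Unary.Properties using (≐-refl; ≐-sym; ≐-trans)

-- Monotone maps and increasing lists of indices.

stepwise-monotone : (φ : ℕ → ℕ) → (∀ n → φ n ≤ φ (suc n)) → ∀ {m n} → m ≤ n → φ m ≤ φ n
stepwise-monotone φ step {n = zero}  z≤n = ≤-refl
stepwise-monotone φ step {m} {suc n} m≤1+n with m≤n⇒m<n∨m≡n m≤1+n
... | inj₁ m<1+n = ≤-trans (stepwise-monotone φ step (s≤s⁻¹ m<1+n)) (step n)
... | inj₂ refl  = ≤-refl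

stepwise-strictlyMonotone : (φ : ℕ → ℕ) → (∀ n → φ n < φ (suc n)) → φ Preserves _<_ ⟶ _<_
stepwise-strictlyMonotone φ step {m} m<n =
  ≤-trans (step m) (stepwise-monotone φ (λ n → <⇒≤ (step n)) m<n)

stepwise-inflationary : (φ : ℕ → ℕ) → (∀ n → φ n < φ (suc n)) → ∀ n → n ≤ φ n
stepwise-inflationary φ step zero    = z≤n
stepwise-inflationary φ step (suc n) = ≤-trans (s≤s (stepwise-inflationary φ step n)) (step n)

-- The bounds delimit a half-open interval, so that lists over adjacent intervals can be
-- concatenated.
data Increasing (l u : ℕ) : ∀ {m} → Vec ℕ m → Set where
  []  : l ≤ u → Increasing l u []
  _∷_ : ∀ {m i} {is : Vec ℕ m} → l ≤ i → Increasing (suc i) u is → Increasing l u (i ∷ is)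

Increasing-weaken : ∀ {l l′ u m} {is : Vec ℕ m} → l ≤ l′ → Increasing l′ u is → Increasing l u is
Increasing-weaken l≤l′ ([] l′≤u)   = [] (≤-trans l≤l′ l′≤u)
Increasing-weaken l≤l′ (l′≤i ∷ is) = ≤-trans l≤l′ l′≤i ∷ is

Increasing-++ : ∀ {l k u m n} {is : Vec ℕ m} {js : Vec ℕ n} →
                Increasing l k is → Increasing k u js → Increasing l u (is ++ js)
Increasing-++ ([] l≤k)   js = Increasing-weaken l≤k js
Increasing-++ (l≤i ∷ is) js = l≤i ∷ Increasing-++ is js

Increasing⇒≤lookup : ∀ {l u m} {is : Vec ℕ m} → Increasing l u is → ∀ j → l ≤ lookup is j
Increasing⇒≤lookup (l≤i ∷ is) zero    = l≤i
Increasing⇒≤lookup (l≤i ∷ is) (suc j) = ≤-trans l≤i (<⇒≤ (Increasing⇒≤lookup is j))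

Increasing⇒lookup-monotone : ∀ {l u m} {is : Vec ℕ m} → Increasing l u is →
                             lookup is Preserves _<ᶠ_ ⟶ _<_
Increasing⇒lookup-monotone (l≤i ∷ is) {zero}  {suc j} _   = Increasing⇒≤lookup is j
Increasing⇒lookup-monotone (l≤i ∷ is) {suc _} {suc _} i<j = Increasing⇒lookup-monotone is (s<s⁻¹ i<j)

-- Concatenation of infinitely many nonempty blocks of indices.

module _ {k : ℕ → ℕ} (is : ∀ n → Vec ℕ (suc (k n))) where

  -- The entries of xs, followed by those of is n, is (1 + n), ….
  flatten : ∀ {m} → ℕ → Vec ℕ m → Seq ℕ
  flatten n (x ∷ xs) zero    = x
  flatten n (x ∷ xs) (suc t) = flatten n xs t
  flatten n []       zero    = head (is n)
  flatten n []       (suc t) = flatten (suc n) (tail (is n)) t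

  flatten-head : ∀ {m} n (xs : Vec ℕ (suc m)) → head xs ≡ flatten n xs 0
  flatten-head n (x ∷ xs) = refl

  flatten-tail : ∀ {m} n (xs : Vec ℕ (suc m)) t → flatten n (tail xs) t ≡ flatten n xs (suc t)
  flatten-tail n (x ∷ xs) t = refl

  flatten-[] : ∀ n t → flatten n [] t ≡ flatten (suc n) (is n) t
  flatten-[] n zero    = flatten-head (suc n) (is n)
  flatten-[] n (suc t) = flatten-tail (suc n) (is n) t

  flatten-lookup : ∀ {m} n (xs : Vec ℕ m) j → flatten n xs (toℕ j) ≡ lookup xs j
  flatten-lookup n (x ∷ xs) zero    = refl
  flatten-lookup n (x ∷ xs) (suc j) = flatten-lookup n xs j

  flatten-skip : ∀ {m} n (xs : Vec ℕ m) t → flatten n xs (m + t) ≡ flatten n [] t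
  flatten-skip n []       t = refl
  flatten-skip n (x ∷ xs) t = flatten-skip n xs t

  flatten-offset : ∀ n t → flatten 0 [] (offset (suc ∘ k) n + t) ≡ flatten n [] t
  flatten-offset zero    t = refl
  flatten-offset (suc n) t = begin
    flatten 0 [] (offset (suc ∘ k) n + suc (k n) + t)   ≡⟨ cong (flatten 0 []) (+-assoc (offset (suc ∘ k) n) _ t) ⟩
    flatten 0 [] (offset (suc ∘ k) n + (suc (k n) + t)) ≡⟨ flatten-offset n _ ⟩
    flatten n [] (suc (k n) + t)                        ≡⟨ flatten-[] n (suc (k n) + t) ⟩
    flatten (suc n) (is n) (suc (k n) + t)              ≡⟨ flatten-skip (suc n) (is n) t ⟩
    flatten (suc n) [] t                                ∎
    where open ≡-Reasoning

  module _ {p : ℕ → ℕ} (incr : ∀ n → Increasing (p n) (p (suc n)) (is n)) where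

    flatten-≥ : ∀ {l m} n {xs : Vec ℕ m} → Increasing l (p n) xs → l ≤ flatten n xs 0
    flatten-≥ n (l≤x ∷ _)  = l≤x
    flatten-≥ n ([] l≤pn) with is n | incr n
    ... | _ ∷ _ | pn≤i ∷ _ = ≤-trans l≤pn pn≤i

    flatten-< : ∀ {l m} n {xs : Vec ℕ m} → Increasing l (p n) xs →
                ∀ t → flatten n xs t < flatten n xs (suc t)
    flatten-< n (_ ∷ xs) zero    = flatten-≥ n xs
    flatten-< n (_ ∷ xs) (suc t) = flatten-< n xs t
    flatten-< n ([] _) zero    with is n | incr n
    ... | _ ∷ _ | _ ∷ xs = flatten-≥ (suc n) xs
    flatten-< n ([] _) (suc t) with is n | incr n
    ... | _ ∷ _ | _ ∷ xs = flatten-< (suc n) xs t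

-- Values of orderly terms, located by intervals of indices.

module _ {A : Set} (F : Operations A) where

  -- Value b l u x: x is the value of an orderly term at a subsequence of b
  -- whose indices lie in the interval [l , u).
  mutual

    data Value (b : Seq A) (l u : ℕ) : A → Set where
      entry : ∀ {n} → l ≤ n → n < u → Value b l u (b n)
      apply : ∀ {k f xs} → (k , f) ∈ F → Values b l u xs → Value b l u (f xs)

    data Values (b : Seq A) (l u : ℕ) : ∀ {m} → Vec A m → Set where
      []  : l ≤ u → Values b l u []
      _∷_ : ∀ {m k x} {xs : Vec A m} → Value b l k x → Values b k u xs → Values b l u (x ∷ xs)

module _ {A : Set} {F : Operations A} where

  mutual

    Value-weaken : ∀ {b l l′ u u′ x} → l ≤ l′ → u′ ≤ u → Value F b l′ u′ x → Value F b l u x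
    Value-weaken l≤l′ u′≤u (entry l′≤n n<u′) = entry (≤-trans l≤l′ l′≤n) (≤-trans n<u′ u′≤u)
    Value-weaken l≤l′ u′≤u (apply f∈F vs)    = apply f∈F (Values-weaken l≤l′ u′≤u vs)

    Values-weaken : ∀ {b l l′ u u′ m} {xs : Vec A m} → l ≤ l′ → u′ ≤ u →
                    Values F b l′ u′ xs → Values F b l u xs
    Values-weaken l≤l′ u′≤u ([] l′≤u′) = [] (≤-trans l≤l′ (≤-trans l′≤u′ u′≤u))
    Values-weaken l≤l′ u′≤u (v ∷ vs)   = Value-weaken l≤l′ ≤-refl v ∷ Values-weaken ≤-refl u′≤u vs

  mutual

    Value⇒< : ∀ {b l u x} → Value F b l u x → l < u
    Value⇒< (entry l≤n n<u)      = ≤-<-trans l≤n n<u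
    Value⇒< (apply f∈F (v ∷ vs)) = <-≤-trans (Value⇒< v) (Values⇒≤ vs)

    Values⇒≤ : ∀ {b l u m} {xs : Vec A m} → Values F b l u xs → l ≤ u
    Values⇒≤ ([] l≤u)  = l≤u
    Values⇒≤ (v ∷ vs) = ≤-trans (<⇒≤ (Value⇒< v)) (Values⇒≤ vs)

  module _ {a b : Seq A} (p : ℕ → ℕ) (p-mono : ∀ {m n} → m ≤ n → p m ≤ p n) (j : ℕ)
           (a-values : ∀ {n} → j ≤ n → Value F b (p n) (p (suc n)) (a n)) where

    mutual

      -- Each entry of `a` is replaced by its value over `b`; `p` carries intervals to intervals.
      -- Entries before `j` are exempt, so that `p` may be truncated subtraction, as in
      -- `⊆Tail-dropSeq`.
      Value-map : ∀ {l u x} → j ≤ l → Value F a l u x → Value F b (p l) (p u) x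
      Value-map j≤l (entry l≤n n<u) = Value-weaken (p-mono l≤n) (p-mono n<u) (a-values (≤-trans j≤l l≤n))
      Value-map j≤l (apply f∈F vs)  = apply f∈F (Values-map j≤l vs)

      Values-map : ∀ {l u m} {xs : Vec A m} → j ≤ l → Values F a l u xs → Values F b (p l) (p u) xs
      Values-map j≤l ([] l≤u)  = [] (p-mono l≤u)
      Values-map j≤l (v ∷ vs) = Value-map j≤l v ∷ Values-map (≤-trans j≤l (<⇒≤ (Value⇒< v))) vs

  Values-split : ∀ m {n b l u} {xs : Vec A (m + n)} → Values F b l u xs →
                 ∃[ k ] Values F b l k (take m xs) × Values F b k u (drop m xs)
  Values-split zero vs       = _ , [] ≤-refl , vs
  Values-split (suc m) (v ∷ vs) with Values-split m vs
  ... | k , vs₁ , vs₂ = k , v ∷ vs₁ , vs₂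

  blocks-values : ∀ {n b l u} (ms : Vec ℕ n) (hs : ∀ i → Op A (lookup ms i)) →
                  (∀ i {l u ys} → Values F b l u ys → Value F b l u (hs i ys)) → ∀ {xs} →
                  Values F b l u xs → Values F b l u (tabulate λ i → hs i (block ms xs i))
  blocks-values []       hs hs-value ([] l≤u) = [] l≤u
  blocks-values (m ∷ ms) hs hs-value vs with Values-split m vs
  ... | k , vs₁ , vs₂ = hs-value zero vs₁ ∷ blocks-values ms (hs ∘ suc) (hs-value ∘ suc) vs₂

  -- The blocks of a composition occupy consecutive intervals, so the inner terms yield values that
  -- can again serve as arguments, in order, of the outer one.
  orderly-value : ∀ {m b l u} {f : Op A m} → OrderlyTerm F f →
                  ∀ {xs} → Values F b l u xs → Value F b l u (f xs)
  orderly-value (basic f∈F)           vs           = apply f∈F vs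
  orderly-value identity              (v ∷ [] k≤u) = Value-weaken ≤-refl k≤u v
  orderly-value (compose {ms = ms} g hs) vs =
    orderly-value g (blocks-values ms _ (λ i → orderly-value (hs i)) vs)

  -- The arity is a successor because `flatten` works with nonempty blocks only.
  record Represented (b : Seq A) (l u : ℕ) (x : A) : Set where
    field
      {arity}    : ℕ
      term       : Op A (suc arity)
      orderly    : OrderlyTerm F term
      indices    : Vec ℕ (suc arity)
      increasing : Increasing l u indices
      value      : x ≡ term (map b indices)

  record AllRepresented (b : Seq A) (l u : ℕ) {n} (xs : Vec A n) : Set where
    field
      arities    : Vec ℕ n
      term       : ∀ i → Op A (lookup arities i)
      orderly    : ∀ i → OrderlyTerm F (term i)
      indices    : Vec ℕ (sum arities)
      increasing : Increasing l u indices
      value      : xs ≡ tabulate λ i → term i (block arities (map b indices) i)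

  consRepresented : ∀ {b l k u x n} {xs : Vec A n} → Represented b l k x → AllRepresented b k u xs →
                    AllRepresented b l u (x ∷ xs)
  consRepresented {b} r rs = record
    { arities    = suc R.arity ∷ Rs.arities
    ; term       = λ { zero → R.term ; (suc i) → Rs.term i }
    ; orderly    = λ { zero → R.orderly ; (suc i) → Rs.orderly i }
    ; indices    = R.indices ++ Rs.indices
    ; increasing = Increasing-++ R.increasing Rs.increasing
    ; value      = cong₂ _∷_ (trans R.value (cong R.term (sym (proj₁ cut))))
                             (trans Rs.value (cong (λ zs → tabulate λ i → Rs.term i (block Rs.arities zs i))
                                                   (sym (proj₂ cut))))
    }
    where
    module R = Represented r
    module Rs = AllRepresented rs
    ys = map b (R.indices ++ Rs.indices)
    cut : take (suc R.arity) ys ≡ map b R.indices × drop (suc R.arity) ys ≡ map b Rs.indices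
    cut = ++-injective (take (suc R.arity) ys) (map b R.indices)
            (trans (take++drop≡id (suc R.arity) ys) (map-++ b R.indices Rs.indices))

  mutual

    represent : ∀ {b l u x} → Value F b l u x → Represented b l u x
    represent (entry {n} l≤n n<u)  = record
      { orderly = identity ; indices = n ∷ [] ; increasing = l≤n ∷ [] n<u ; value = refl }
    -- Exposing the first argument makes the sum of the arities a successor by computation.
    represent (apply {f = f} f∈F (v ∷ vs)) = record
      { orderly    = compose {hs = Rs.term} (basic f∈F) Rs.orderly
      ; indices    = Rs.indices
      ; increasing = Rs.increasing
      ; value      = cong f Rs.value
      }
      where module Rs = AllRepresented (consRepresented (represent v) (represent-all vs))

    represent-all : ∀ {b l u n} {xs : Vec A n} → Values F b l u xs → AllRepresented b l u xs
    represent-all ([] l≤u) = record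
      { arities = [] ; term = λ () ; orderly = λ () ; indices = [] ; increasing = [] l≤u ; value = refl }
    represent-all (v ∷ vs) = consRepresented (represent v) (represent-all vs)

  Value⇒FR : ∀ {b l u x} → Value F b l u x → x ∈ FR F b
  Value⇒FR {b} v = _ , R.term , map b R.indices , R.orderly
    , (lookup R.indices , Increasing⇒lookup-monotone R.increasing , λ i → lookup-map i b R.indices)
    , R.value
    where module R = Represented (represent v)

  subsequence-values : ∀ {m b} {l} {xs : Vec A m} → (φ : Fin m → ℕ) → φ Preserves _<ᶠ_ ⟶ _<_ →
                       (∀ i → l ≤ φ i) → lookup xs ≗ b ∘ φ → ∃[ u ] Values F b l u xs
  subsequence-values {l = l} {[]} φ φ-mono l≤ eq = l , [] ≤-refl
  subsequence-values {b = b} {xs = x ∷ xs} φ φ-mono l≤ eq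
    with subsequence-values {l = suc (φ zero)} (φ ∘ suc) (φ-mono ∘ s≤s) (λ i → φ-mono (s≤s z≤n)) (eq ∘ suc)
  ... | u , vs = u , subst (Value F b _ _) (sym (eq zero)) (entry (l≤ zero) ≤-refl) ∷ vs

  FR⇒Value : ∀ {b x} → x ∈ FR F b → ∃[ u ] Value F b 0 u x
  FR⇒Value {b} (m , f , xs , of , (φ , φ-mono , eq) , refl) with subsequence-values φ φ-mono (λ _ → z≤n) eq
  ... | u , vs = u , orderly-value of vs

-- Reduction, expressed by cut points.

-- Equivalent to `≤[ F ]` by `≤⇒≼` and `≼⇒≤`, but the finite pieces are replaced by cut points `p`,
-- and transitivity becomes composition of the cut points.
_≼[_]_ : {A : Set} → Seq A → Operations A → Seq A → Set
a ≼[ F ] b = Σ (ℕ → ℕ) λ p → ∀ n → Value F b (p n) (p (suc n)) (a n)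

module _ {A : Set} {F : Operations A} where

  positions-< : ∀ {a b} (a≼b : a ≼[ F ] b) n → proj₁ a≼b n < proj₁ a≼b (suc n)
  positions-< (p , v) n = Value⇒< (v n)

  ≼-value : ∀ {a b} (a≼b@(p , _) : a ≼[ F ] b) {l u x} → Value F a l u x → Value F b (p l) (p u) x
  ≼-value a≼b@(p , v) = Value-map p (stepwise-monotone p (<⇒≤ ∘ positions-< a≼b)) 0 (λ {n} _ → v n) z≤n

  ≼-refl : ∀ {a} → a ≼[ F ] a
  ≼-refl = id , λ n → entry ≤-refl ≤-refl

  ≼-trans : ∀ {a b c} → a ≼[ F ] b → b ≼[ F ] c → a ≼[ F ] c
  ≼-trans (p , v) b≼c@(q , _) = q ∘ p , λ n → ≼-value b≼c (v n)

  dropSeq-≼ : ∀ j (a : Seq A) → dropSeq j a ≼[ F ] a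
  dropSeq-≼ j a = j +_ , λ n → entry ≤-refl (≤-reflexive (sym (+-suc j n)))

  block-values : ∀ {m b} {φ : ℕ → ℕ} → (∀ t → φ t < φ (suc t)) → ∀ s {xs : Vec A m} →
                 (∀ j → lookup xs j ≡ b (φ (s + toℕ j))) → Values F b (φ s) (φ (s + m)) xs
  block-values {φ = φ} φ-< s {[]}     eq = [] (≤-reflexive (cong φ (sym (+-identityʳ s))))
  block-values {suc m} {b} {φ} φ-< s {x ∷ xs} eq =
    subst (Value F b (φ s) (φ (suc s)))
      (sym (trans (eq zero) (cong (b ∘ φ) (+-identityʳ s)))) (entry ≤-refl (φ-< s))
    ∷ subst (λ u → Values F b (φ (suc s)) (φ u) xs) (sym (+-suc s m))
        (block-values φ-< (suc s) λ j → trans (eq (suc j)) (cong (b ∘ φ) (+-suc s (toℕ j))))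

  -- The n-th piece starts at position `offset arity n` of the concatenation; `φ` carries these
  -- positions to cut points in `b`.
  ≤⇒≼ : ∀ {a b} → a ≤[ F ] b → a ≼[ F ] b
  ≤⇒≼ {a} {b} a≤b = φ ∘ offset arity , λ n →
    subst (Value F b _ _) (sym (value n))
      (orderly-value (orderly n) (block-values (λ t → φ-mono (n<1+n t)) (offset arity n)
        λ j → trans (sym (isConcat n j)) (c≗ _)))
    where
    open _≤[_]_ a≤b
    φ = proj₁ subsequence
    φ-mono = proj₁ (proj₂ subsequence)
    c≗ = proj₂ (proj₂ subsequence)

  -- The index lists representing the successive values lie in adjacent intervals, so their
  -- concatenation enumerates a subsequence of `b`.
  ≼⇒≤ : ∀ {a b} → a ≼[ F ] b → a ≤[ F ] b
  ≼⇒≤ {a} {b} (p , v) = record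
    { arity         = λ n → suc (R.arity n)
    ; pieces        = λ n → map b (R.indices n)
    ; terms         = R.term
    ; concatenation = b ∘ φ
    ; orderly       = R.orderly
    ; isConcat      = λ n j → trans (cong b (φ-offset n j)) (sym (lookup-map j b (R.indices n)))
    ; subsequence   = φ , stepwise-strictlyMonotone φ (flatten-< R.indices R.increasing 0 ([] z≤n)) , λ _ → refl
    ; value         = R.value
    }
    where
    module R n = Represented (represent (v n))
    φ = flatten R.indices 0 []
    φ-offset : ∀ n j → φ (offset (λ n → suc (R.arity n)) n + toℕ j) ≡ lookup (R.indices n) j
    φ-offset n j = begin
      φ (offset (λ n → suc (R.arity n)) n + toℕ j)      ≡⟨ flatten-offset R.indices n (toℕ j) ⟩
      flatten R.indices n [] (toℕ j)                    ≡⟨ flatten-[] R.indices n (toℕ j) ⟩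
      flatten R.indices (suc n) (R.indices n) (toℕ j)   ≡⟨ flatten-lookup R.indices (suc n) (R.indices n) j ⟩
      lookup (R.indices n) j                            ∎
      where open ≡-Reasoning

-- Tails and decided sets.

module _ {A : Set} (F : Operations A) where

  -- This is FR of the sequence from `j` on (see `FR-dropSeq≐Tail`), without reindexing the
  -- sequence.
  Tail : Seq A → ℕ → Pred A 0ℓ
  Tail b j x = ∃[ u ] Value F b j u x

  Decides : Seq A → Pred A 0ℓ → Set
  Decides b X = ∃[ j ] (Tail b j ⊆ X ⊎ Tail b j ⊆ ∁ X)

module _ {A : Set} {F : Operations A} where

  Tail⇒FR : ∀ {b} → Tail F b 0 ⊆ FR F b
  Tail⇒FR (_ , v) = Value⇒FR v

  entry∈Tail : ∀ b j → b j ∈ Tail F b j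
  entry∈Tail b j = suc j , entry ≤-refl ≤-refl

  Tail-antitone : ∀ {b i j} → i ≤ j → Tail F b j ⊆ Tail F b i
  Tail-antitone i≤j (u , v) = u , Value-weaken i≤j ≤-refl v

  -- Cut points increase strictly, so the one at `j` is at least `j`.
  ≼⇒Tail⊆ : ∀ {a b} → a ≼[ F ] b → ∀ {j} → Tail F a j ⊆ Tail F b j
  ≼⇒Tail⊆ a≼b@(p , _) {j} (u , v) =
    p u , Value-weaken (stepwise-inflationary p (positions-< a≼b) j) ≤-refl (≼-value a≼b v)

  Tail-dropSeq⊆ : ∀ {b} j {i} → Tail F (dropSeq j b) i ⊆ Tail F b (j + i)
  Tail-dropSeq⊆ {b} j (u , v) = j + u , ≼-value (dropSeq-≼ j b) v

  ⊆Tail-dropSeq : ∀ {b} j {i} → Tail F b (j + i) ⊆ Tail F (dropSeq j b) i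
  ⊆Tail-dropSeq {b} j {i} (u , v) = u ∸ j ,
    subst (λ l → Value F (dropSeq j b) l (u ∸ j) _) (m+n∸m≡n j i)
      (Value-map (_∸ j) (∸-monoˡ-≤ j) j shifted (m≤m+n j i) v)
    where
    shifted : ∀ {n} → j ≤ n → Value F (dropSeq j b) (n ∸ j) (suc n ∸ j) (b n)
    shifted {n} j≤n = subst (Value F (dropSeq j b) _ _) (cong b (m+[n∸m]≡n j≤n))
      (entry ≤-refl (≤-reflexive (sym (+-∸-assoc 1 j≤n))))

  Decides-≼ : ∀ {a b X} → a ≼[ F ] b → Decides F b X → Decides F a X
  Decides-≼ a≼b (j , inj₁ ⊆X)  = j , inj₁ (⊆X ∘ ≼⇒Tail⊆ a≼b)
  Decides-≼ a≼b (j , inj₂ ⊆∁X) = j , inj₂ (⊆∁X ∘ ≼⇒Tail⊆ a≼b)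

  -- Each new occurrence of `x` is sought beyond the interval used for the previous one.
  constant-≼ : ∀ {a x} → (∀ l → x ∈ Tail F a l) → (λ _ → x) ≼[ F ] a
  constant-≼ {a} {x} x∈ = p , λ n → proj₂ (x∈ (p n))
    where
    p : ℕ → ℕ
    p zero    = 0
    p (suc n) = proj₁ (x∈ (p n))

  -- Fusion, and homogeneity for countably many sets at once.

  module Fusion (b : ℕ → Seq A) (b-≼ : ∀ n → b (suc n) ≼[ F ] dropSeq 1 (b n)) where

    diagonal : Seq A
    diagonal n = b n 0

    successor-≼ : ∀ n → b (suc n) ≼[ F ] b n
    successor-≼ n = ≼-trans (b-≼ n) (dropSeq-≼ 1 (b n))

    -- The index in b n at which the part used for b (n + k) 0 begins; it is
    -- positive for k ≥ 1 because b (1 + n) avoids b n 0.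
    start : ℕ → ℕ → ℕ
    start n zero    = 0
    start n (suc k) = proj₁ (successor-≼ n) (start (suc n) k)

    diagonal-value : ∀ n k → Value F (b n) (start n k) (start n (suc k)) (diagonal (n + k))
    diagonal-value n zero rewrite +-identityʳ n = entry z≤n (s≤s z≤n)
    diagonal-value n (suc k) rewrite +-suc n k =
      ≼-value (successor-≼ n) (diagonal-value (suc n) k)

    diagonal-≼ : ∀ n → dropSeq n diagonal ≼[ F ] b n
    diagonal-≼ n = start n , diagonal-value n

  module _ (ramsey : IsRamsey A F) where

    homogeneous : ∀ a X → ∃[ b ] b ≼[ F ] a × (Tail F b 0 ⊆ X ⊎ Tail F b 0 ⊆ ∁ X)
    homogeneous a X with ramsey a X
    ... | b , b≤a , inj₁ ⊆X = b , ≤⇒≼ b≤a , inj₁ (⊆X ∘ Tail⇒FR)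
    ... | b , b≤a , inj₂ ⊥X = b , ≤⇒≼ b≤a , inj₂ λ t x∈X → ⊥X (Tail⇒FR t , x∈X)

    -- The sequence `bs n` is homogeneous for `X n` and reduces its predecessor without the first
    -- entry. The diagonal reduces `bs n` only from index `n` on, hence decisions by tails.
    decide-all : ∀ a (X : ℕ → Pred A 0ℓ) → ∃[ b ] b ≼[ F ] a × (∀ n → Decides F b (X n))
    decide-all a X = diagonal , ≼-trans (diagonal-≼ 0) (proj₁ (proj₂ (homogeneous a (X 0)))) , decides
      where
      bs : ℕ → Seq A
      bs zero    = proj₁ (homogeneous a (X 0))
      bs (suc n) = proj₁ (homogeneous (dropSeq 1 (bs n)) (X (suc n)))

      open Fusion bs (λ n → proj₁ (proj₂ (homogeneous (dropSeq 1 (bs n)) (X (suc n)))))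

      bs-homogeneous : ∀ n → Tail F (bs n) 0 ⊆ X n ⊎ Tail F (bs n) 0 ⊆ ∁ (X n)
      bs-homogeneous zero    = proj₂ (proj₂ (homogeneous a (X 0)))
      bs-homogeneous (suc n) = proj₂ (proj₂ (homogeneous (dropSeq 1 (bs n)) (X (suc n))))

      tail⊆ : ∀ n → Tail F diagonal n ⊆ Tail F (bs n) 0
      tail⊆ n {x} t = ≼⇒Tail⊆ (diagonal-≼ n)
        (⊆Tail-dropSeq n (subst (λ l → x ∈ Tail F diagonal l) (sym (+-identityʳ n)) t))

      decides : ∀ n → Decides F diagonal (X n)
      decides n with bs-homogeneous n
      ... | inj₁ ⊆X  = n , inj₁ (⊆X ∘ tail⊆ n)
      ... | inj₂ ⊆∁X = n , inj₂ (⊆∁X ∘ tail⊆ n)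

-- Codings by natural numbers and countable collections.

-- Cantor's walk along the antidiagonals.
unpair : ℕ → ℕ × ℕ
unpair zero    = 0 , 0
unpair (suc k) with unpair k
... | zero  , n = suc n , 0
... | suc m , n = m , suc n

-- The walk is followed backwards: along the antidiagonal by recursion on `n`, then to the end of
-- the previous antidiagonal, by recursion on the sum.
unpair-surjective : ∀ m n → ∃[ k ] unpair k ≡ (m , n)
unpair-surjective m n = go (m + n) m n refl
  where
  go : ∀ s m n → m + n ≡ s → ∃[ k ] unpair k ≡ (m , n)
  go s       zero    zero    eq   = 0 , refl
  go (suc s) (suc m) zero    eq with go s 0 m (trans (sym (+-identityʳ m)) (suc-injective eq))
  ... | k , eqₖ = suc k , lemma
    where
    lemma : unpair (suc k) ≡ (suc m , 0)
    lemma rewrite eqₖ = refl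
  go s       m       (suc n) eq with go s (suc m) n (trans (sym (+-suc m n)) eq)
  ... | k , eqₖ = suc k , lemma
    where
    lemma : unpair (suc k) ≡ (m , suc n)
    lemma rewrite eqₖ = refl

vector : ∀ n → ℕ → Vec ℕ n
vector zero    k = []
vector (suc n) k = proj₁ (unpair k) ∷ vector n (proj₂ (unpair k))

vector-surjective : ∀ {n} (v : Vec ℕ n) → ∃[ k ] vector n k ≡ v
vector-surjective []      = 0 , refl
vector-surjective (a ∷ v) with vector-surjective v
... | i , eqᵢ with unpair-surjective a i
... | k , eqₖ = k , cong₂ _∷_ (cong proj₁ eqₖ) (trans (cong (vector _ ∘ proj₂) eqₖ) eqᵢ)

module _ {c ℓ p} {S : Setoid c ℓ} {P : Pred (Setoid.Carrier S) p} where

  open Setoid S using (Carrier; _≈_)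

  -- Excluded middle inverts the injection on its range; `x₀` fills the gaps.
  enumerate : ExcludedMiddle (c ⊔ₗ p) → Carrier → Countable S P → ∃[ e ] ∀ {x} → P x → ∃[ k ] x ≈ e k
  enumerate em x₀ countable = (λ k → element k em) , λ {x} px → to (x , px) , listed x px em
    where
    open Injection countable using (to; injective)
    Preimage : ℕ → Set _
    Preimage k = ∃[ y ] to y ≡ k

    -- The decision is an argument so that `listed` can split on it.
    element : ∀ k → Dec (Preimage k) → Carrier
    element k (yes ((x , _) , _)) = x
    element k (no _)              = x₀

    listed : ∀ x px (d : Dec (Preimage (to (x , px)))) → x ≈ element (to (x , px)) d
    listed x px (yes (_ , eq)) = injective (sym eq)
    listed x px (no ∄)         = ⊥-elim (∄ (_ , refl))

Least : (ℕ → Set) → ℕ → Set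
Least P m = P m × (∀ {n} → P n → m ≤ n)

least : ExcludedMiddle 0ℓ → ∀ P {n} → P n → ∃ (Least P)
least em P {zero}  p = 0 , p , λ _ → z≤n
least em P {suc n} p with em {P 0}
... | yes p₀ = 0 , p₀ , λ _ → z≤n
... | no ¬p₀ with least em (P ∘ suc) p
... | m , pₘ , m≤ = suc m , pₘ , λ { {zero} p₀ → ⊥-elim (¬p₀ p₀) ; {suc n} pₙ → s≤s (m≤ pₙ) }

-- Taking the least index makes the map independent of the way membership is proved and of the
-- representative of an extensional class.
enumerated⇒countable : ExcludedMiddle 0ℓ → ∀ {S : Set} {𝒜 : Collection S} (e : ℕ → Pred S 0ℓ) →
                       (∀ {X} → X ∈ 𝒜 → ∃[ k ] X ≐ e k) → CountableCollection 𝒜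
enumerated⇒countable em e listed = record
  { to        = λ (X , X∈𝒜) → proj₁ (index X X∈𝒜)
  ; cong      = λ {(X , X∈𝒜)} {(Y , Y∈𝒜)} X≐Y →
      let i , X≐eᵢ , i≤ = index X X∈𝒜
          j , Y≐eⱼ , j≤ = index Y Y∈𝒜
      in ≤-antisym (i≤ (≐-trans X≐Y Y≐eⱼ)) (j≤ (≐-trans (≐-sym X≐Y) X≐eᵢ))
  ; injective = λ {(X , X∈𝒜)} {(Y , Y∈𝒜)} i≡j →
      let i , X≐eᵢ , _ = index X X∈𝒜
          j , Y≐eⱼ , _ = index Y Y∈𝒜
      in ≐-trans X≐eᵢ (≐-sym (subst (λ k → Y ≐ e k) (sym i≡j) Y≐eⱼ))
  }
  where
  index : ∀ X → _ → ∃ (Least λ k → X ≐ e k)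
  index X X∈𝒜 = least em _ (proj₂ (listed X∈𝒜))

preimage-cong : ∀ {S T : Set} (g : S → T) {X Y : Pred T 0ℓ} → X ≐ Y → (g ⊢ X) ≐ (g ⊢ Y)
preimage-cong g (⊆Y , ⊇Y) = ⊆Y , ⊇Y

FR-dropSeq≐Tail : ∀ {A} {F : Operations A} j {b} → FR F (dropSeq j b) ≐ Tail F b j
FR-dropSeq≐Tail {F = F} j {b} =
  Tail-antitone (m≤m+n j 0) ∘ Tail-dropSeq⊆ j ∘ FR⇒Value ,
  λ {x} t → Tail⇒FR (⊆Tail-dropSeq j (subst (λ l → x ∈ Tail F b l) (sym (+-identityʳ j)) t))

-- Presentations and the rules extending them.

-- `e n` lists countably many subsets of the n-th power of ω, possibly with repetitions.
Sets : Set₁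
Sets = ∀ n → ℕ → Pred (Vec ℕ n) 0ℓ

data Rule : Set where
  keep complement rotate quantify tailSet singleton : ℕ → Rule
  union intersection section : ℕ → ℕ → Rule
  substitution : ℕ → ℕ → ℕ → Rule

select : ℕ → ℕ → ℕ → ℕ → Rule
select 0 i j l = keep i
select 1 i j l = complement i
select 2 i j l = rotate i
select 3 i j l = quantify i
select 4 i j l = tailSet i
select 5 i j l = singleton i
select 6 i j l = union i j
select 7 i j l = intersection i j
select 8 i j l = section i j
select _ i j l = substitution i j l

-- Numbers code rules, so that the results of all single rule applications form a presentation
-- again.
rule : ℕ → Rule
rule k = let t , k′ = unpair k ; i , k″ = unpair k′ ; j , l = unpair k″ in select t i j l

rule-select : ∀ t i j l → ∃[ k ] rule k ≡ select t i j l
rule-select t i j l with unpair-surjective j l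
... | k″ , eq″ with unpair-surjective i k″
... | k′ , eq′ with unpair-surjective t k′
... | k  , eq = k , lemma
  where
  lemma : rule k ≡ select t i j l
  lemma rewrite eq | eq′ | eq″ = refl

rule-surjective : ∀ ρ → ∃[ k ] rule k ≡ ρ
rule-surjective (keep i)             = rule-select 0 i 0 0
rule-surjective (complement i)       = rule-select 1 i 0 0
rule-surjective (rotate i)           = rule-select 2 i 0 0
rule-surjective (quantify i)         = rule-select 3 i 0 0
rule-surjective (tailSet i)          = rule-select 4 i 0 0
rule-surjective (singleton i)        = rule-select 5 i 0 0
rule-surjective (union i j)          = rule-select 6 i j 0
rule-surjective (intersection i j)   = rule-select 7 i j 0
rule-surjective (section i a)        = rule-select 8 i a 0
rule-surjective (substitution i p j) = rule-select 9 i p j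

-- Stated at every arity `n`, since `derive` must be total; the set is empty unless `n` is the right
-- arity.
substituted : ∀ {p} → Pred (Vec ℕ (suc p)) 0ℓ → Operation ℕ → ∀ n → Pred (Vec ℕ n) 0ℓ
substituted {p} X (k , f) n v = Σ (n ≡ p + suc k) λ eq →
  let w = subst (Vec ℕ) eq v in (take p w ∷ʳ f (drop p w)) ∈ X

substituted-≈ₒ : ∀ {p} {X Y : Pred (Vec ℕ (suc p)) 0ℓ} → X ≐ Y →
                 ∀ {k} {f : Op ℕ (suc k)} {o} → (k , f) ≈ₒ o →
                 (λ v → (take p v ∷ʳ f (drop p v)) ∈ X) ≐ substituted Y o (p + suc k)
substituted-≈ₒ {p} {X} {Y} (X⊆Y , Y⊆X) {k} {f} (pointwise {g = g} f≗g) =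
  (λ {v} x → refl , X⊆Y (subst (λ y → (take p v ∷ʳ y) ∈ X) (f≗g (drop p v)) x)) ,
  (λ {v} (eq , y) → Y⊆X (back v eq y))
  where
  back : ∀ v (eq : p + suc k ≡ p + suc k) →
         (take p (subst (Vec ℕ) eq v) ∷ʳ g (drop p (subst (Vec ℕ) eq v))) ∈ Y →
         (take p v ∷ʳ f (drop p v)) ∈ Y
  -- Equality proofs between numbers are unique, so the transport disappears.
  back v eq y rewrite ≡-irrelevant eq refl =
    subst (λ z → (take p v ∷ʳ z) ∈ Y) (sym (f≗g (drop p v))) y

-- The simultaneous construction of presentations and sequences.

module Construction (em : ExcludedMiddle 0ℓ) (F : Operations ℕ) (ramsey : IsRamsey ℕ F)
                    (ops : ℕ → Operation ℕ) (e₀ : Sets) (a₀ : Seq ℕ) where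

  -- A rule that does not fit the arity n yields a junk value.
  derive : Sets → Seq ℕ → ∀ n → Rule → Pred (Vec ℕ n) 0ℓ
  derive e b n             (keep i)             = e n i
  derive e b n             (complement i)       = ∁ (e n i)
  derive e b n             (union i j)          = e n i ∪ e n j
  derive e b n             (intersection i j)   = e n i ∩ e n j
  derive e b n             (singleton i)        = ｛ vector n i ｝
  derive e b n             (section i a)        = λ v → (a ∷ v) ∈ e (suc n) i
  derive e b n             (quantify i)         = λ v → ∃[ j ] Tail F b j ⊆ λ a → (v ∷ʳ a) ∈ e (suc n) i
  derive e b n             (substitution i p j) = substituted (e (suc p) j) (ops i) n
  derive e b (suc n)       (tailSet i)          = head ⊢ Tail F b i
  derive e b zero          (tailSet i)          = full
  derive e b (suc (suc n)) (rotate i)           = λ v → (last v ∷ init v) ∈ e (2 + n) i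
  derive e b _             (rotate i)           = full

  -- All arities share one sequence, the form `decide-all` takes. At `n = 0` the sections are the
  -- listed sets of 1-tuples themselves.
  sections : Sets → ℕ → Pred ℕ 0ℓ
  sections e k = let n , k′ = unpair k ; i , l = unpair k′ in
    λ a → (vector n l ∷ʳ a) ∈ e (suc n) i

  sections-surjective : ∀ {n} i (v : Vec ℕ n) →
                        ∃[ k ] ∀ e → sections e k ≡ λ a → (v ∷ʳ a) ∈ e (suc n) i
  sections-surjective {n} i v
    with vector-surjective v
  ... | l , refl with unpair-surjective i l
  ... | k′ , eq′ with unpair-surjective n k′
  ... | k , eq = k , lemma
    where
    lemma : ∀ e → sections e k ≡ λ a → (vector n l ∷ʳ a) ∈ e (suc n) i
    lemma e rewrite eq | eq′ = refl

  mutual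

    e : ℕ → Sets
    e zero      = e₀
    e (suc r) n = derive (e r) (b r) n ∘ rule

    b : ℕ → Seq ℕ
    b r = proj₁ (decide-all ramsey (predecessor r) (sections (e r)))

    predecessor : ℕ → Seq ℕ
    predecessor zero    = a₀
    predecessor (suc r) = b r

  b-≼ : ∀ r → b r ≼[ F ] predecessor r
  b-≼ r = proj₁ (proj₂ (decide-all ramsey (predecessor r) (sections (e r))))

  b-decides : ∀ r {n} i (v : Vec ℕ n) → Decides F (b r) λ a → (v ∷ʳ a) ∈ e r (suc n) i
  b-decides r i v with sections-surjective i v
  ... | k , eq = subst (Decides F (b r)) (eq (e r))
    (proj₂ (proj₂ (decide-all ramsey (predecessor r) (sections (e r)))) k)

  b-antitone : ∀ {r s} → r ≤ s → b s ≼[ F ] b r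
  b-antitone {s = zero}  z≤n = ≼-refl
  b-antitone {r} {suc s} r≤1+s with m≤n⇒m<n∨m≡n r≤1+s
  ... | inj₁ r<1+s = ≼-trans (b-≼ (suc s)) (b-antitone (s≤s⁻¹ r<1+s))
  ... | inj₂ refl  = ≼-refl

  b-≼-a₀ : ∀ r → b r ≼[ F ] a₀
  b-≼-a₀ r = ≼-trans (b-antitone {s = r} z≤n) (b-≼ 0)

  common-tail : ∀ r j s k → ∃[ t ] ∃[ l ] Tail F (b t) l ⊆ Tail F (b r) j ∩ Tail F (b s) k
  common-tail r j s k = r ⊔ s , j ⊔ k , λ t →
    ≼⇒Tail⊆ (b-antitone (m≤m⊔n r s)) (Tail-antitone (m≤m⊔n j k) t) ,
    ≼⇒Tail⊆ (b-antitone (m≤n⊔m r s)) (Tail-antitone (m≤n⊔m j k) t)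

  -- The sequences form a chain under reduction, so any two tails share an entry of a later
  -- sequence.
  tails-meet : ∀ r j s k {X : Pred ℕ 0ℓ} → Tail F (b r) j ⊆ X → ¬ Tail F (b s) k ⊆ ∁ X
  tails-meet r j s k ⊆X ⊆∁X with common-tail r j s k
  ... | t , l , ⊆both with ⊆both (entry∈Tail (b t) l)
  ... | ∈r , ∈s = ⊆∁X ∈s (⊆X ∈r)

  -- The admissible family.

  Stage : ℕ → Family
  Stage r n X = ∃[ i ] X ≐ e r n i

  𝔄 : Family
  𝔄 n X = ∃[ r ] X ∈ Stage r n

  𝔄-resp : ∀ {n X Y} → X ≐ Y → X ∈ 𝔄 n → Y ∈ 𝔄 n
  𝔄-resp X≐Y (r , i , X≐) = r , i , ≐-trans (≐-sym X≐Y) X≐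

  -- Source of the closure properties of `𝔄`: a rule applied to sets of stage `r` gives a set of the
  -- next stage.
  derived : ∀ r {n X} ρ → X ≐ derive (e r) (b r) n ρ → X ∈ Stage (suc r) n
  derived r {n} {X} ρ X≐ with rule-surjective ρ
  ... | k , eq = k , subst (λ ρ → X ≐ derive (e r) (b r) n ρ) (sym eq) X≐

  Stage-monotone : ∀ {r s n X} → r ≤ s → X ∈ Stage r n → X ∈ Stage s n
  Stage-monotone {s = zero}  z≤n x = x
  Stage-monotone {r} {suc s} r≤1+s x with m≤n⇒m<n∨m≡n r≤1+s
  ... | inj₂ refl  = x
  ... | inj₁ r<1+s with Stage-monotone (s≤s⁻¹ r<1+s) x
  ... | i , X≐ = derived s (keep i) X≐

  common-stage : ∀ {n X Y} → X ∈ 𝔄 n → Y ∈ 𝔄 n → ∃[ r ] X ∈ Stage r n × Y ∈ Stage r n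
  common-stage (r , x) (s , y) = r ⊔ s , Stage-monotone (m≤m⊔n r s) x , Stage-monotone (m≤n⊔m r s) y

  𝔄-union : ∀ {n X Y} → X ∈ 𝔄 n → Y ∈ 𝔄 n → (X ∪ Y) ∈ 𝔄 n
  𝔄-union x y with common-stage x y
  ... | r , (i , X⊆ , X⊇) , (j , Y⊆ , Y⊇) =
    suc r , derived r (union i j) (Sum.map X⊆ Y⊆ , Sum.map X⊇ Y⊇)

  𝔄-inter : ∀ {n X Y} → X ∈ 𝔄 n → Y ∈ 𝔄 n → (X ∩ Y) ∈ 𝔄 n
  𝔄-inter x y with common-stage x y
  ... | r , (i , X⊆ , X⊇) , (j , Y⊆ , Y⊇) =
    suc r , derived r (intersection i j) (Product.map X⊆ Y⊆ , Product.map X⊇ Y⊇)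

  𝔄-compl : ∀ {n X} → X ∈ 𝔄 n → ∁ X ∈ 𝔄 n
  𝔄-compl (r , i , X⊆ , X⊇) = suc r , derived r (complement i) ((_∘ X⊇) , (_∘ X⊆))

  𝔄-singleton : ∀ {n} (v : Vec ℕ n) → ｛ v ｝ ∈ 𝔄 n
  𝔄-singleton v with vector-surjective v
  ... | i , refl = 1 , derived 0 (singleton i) ≐-refl

  𝔄-full : ∀ {n} → full ∈ 𝔄 n
  -- The whole space is the complement of `Y ∩ ∁ Y`, where `Y` is the first set listed by `e₀`.
  𝔄-full {n} = 𝔄-resp ((λ _ → tt) , (λ _ (x , ¬x) → ¬x x))
    (𝔄-compl (𝔄-inter e₀∈ (𝔄-compl e₀∈)))
    where
    e₀∈ : e₀ n 0 ∈ 𝔄 n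
    e₀∈ = 0 , 0 , ≐-refl

  𝔄-section : ∀ {n X} → X ∈ 𝔄 (suc n) → ∀ a → (λ v → (a ∷ v) ∈ X) ∈ 𝔄 n
  𝔄-section (r , i , X≐) a = suc r , derived r (section i a) (preimage-cong (a ∷_) X≐)

  𝔄-section* : ∀ {n X} (v : Vec ℕ n) → X ∈ 𝔄 (suc n) → (λ a → (v ∷ʳ a) ∈ X) ∈ unary 𝔄
  𝔄-section* []      x = 𝔄-resp ((λ { {_ ∷ []} → id }) , (λ { {_ ∷ []} → id })) x
  𝔄-section* (a ∷ v) x = 𝔄-section* v (𝔄-section x a)

  𝔄-admissible : IsAdmissible 𝔄
  𝔄-admissible = record
    { isField = λ n → record
      { resp       = 𝔄-resp
      ; nonempty   = full , 𝔄-full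
      ; union      = 𝔄-union
      ; inter      = 𝔄-inter
      ; compl      = 𝔄-compl
      ; singletons = 𝔄-singleton
      }
    ; rotate  = λ n (r , i , X≐) → suc r , derived r (rotate i) (preimage-cong (λ v → last v ∷ init v) X≐)
    ; section = λ n → 𝔄-section
    }

  𝔄-operation : ∀ {k f i} → (k , f) ≈ₒ ops i → Is[ 𝔄 ]-Operation f
  𝔄-operation {i = i} f≈ p (r , j , X≐) = suc r , derived r (substitution i p j) (substituted-≈ₒ X≐ f≈)

  𝔄-countable : ∀ n → CountableCollection (𝔄 n)
  𝔄-countable n = enumerated⇒countable em (λ k → let r , i = unpair k in e r n i) listed
    where
    listed : ∀ {X} → X ∈ 𝔄 n → ∃[ k ] let r , i = unpair k in X ≐ e r n i
    listed {X} (r , i , X≐) with unpair-surjective r i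
    ... | k , eq = k , subst (λ (r , i) → X ≐ e r n i) (sym eq) X≐

  -- The ultrafilter.

  U : Collection ℕ
  U X = X ∈ unary 𝔄 × ∃[ r ] ∃[ j ] Tail F (b r) j ⊆ X

  U-ultra : ∀ {X} → X ∈ unary 𝔄 → X ∈ U ⊎ ∁ X ∈ U
  U-ultra X∈@(r , i , X⊆ , X⊇) with b-decides r i []
  ... | j , inj₁ ⊆X  = inj₁ (X∈ , r , j , X⊇ ∘ ⊆X)
  ... | j , inj₂ ⊆∁X = inj₂ (𝔄-compl X∈ , r , j , λ t x → ⊆∁X t (X⊆ x))

  U-isUltrafilter : IsUltrafilter (unary 𝔄) U
  U-isUltrafilter = record
    { resp   = λ X≐Y (X∈ , r , j , ⊆X) → 𝔄-resp (preimage-cong head X≐Y) X∈ , r , j , proj₁ X≐Y ∘ ⊆X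
    ; subset = proj₁
    ; inter  = λ (X∈ , r , j , ⊆X) (Y∈ , s , k , ⊆Y) →
        let t , l , ⊆both = common-tail r j s k
        in 𝔄-inter X∈ Y∈ , t , l , Product.map ⊆X ⊆Y ∘ ⊆both
    ; whole  = 𝔄-full , 0 , 0 , λ _ → tt
    ; proper = λ (_ , r , j , ⊆∅) → ⊆∅ (entry∈Tail (b r) j)
    ; ultra  = U-ultra
    }

  -- If `X` is listed at stage `r`, then `b r` decides all its sections, and by `tails-meet` no tail
  -- of any other `b s` contradicts the decision. Membership of a section in `U` thus depends on
  -- `b r` alone, which is what the rule `quantify` expresses.
  U-definable : ∀ n {X} → X ∈ 𝔄 (suc n) → (λ v → (λ a → (v ∷ʳ a) ∈ X) ∈ U) ∈ 𝔄 n
  U-definable n {X} X∈@(r , i , X⊆ , X⊇) = suc r , derived r (quantify i) ((λ {v} → to v) , (λ {v} → from v))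
    where
    to : ∀ v → (λ a → (v ∷ʳ a) ∈ X) ∈ U → ∃[ j ] Tail F (b r) j ⊆ λ a → (v ∷ʳ a) ∈ e r (suc n) i
    to v (_ , s , k , ⊆X) with b-decides r i v
    ... | j , inj₁ ⊆Xᵥ  = j , ⊆Xᵥ
    ... | j , inj₂ ⊆∁Xᵥ = ⊥-elim (tails-meet s k r j (X⊆ ∘ ⊆X) ⊆∁Xᵥ)

    from : ∀ v → (∃[ j ] Tail F (b r) j ⊆ λ a → (v ∷ʳ a) ∈ e r (suc n) i) → (λ a → (v ∷ʳ a) ∈ X) ∈ U
    from v (j , ⊆Xᵥ) = 𝔄-section* v X∈ , r , j , X⊇ ∘ ⊆Xᵥ

  -- A tail of some `b r` lies inside the given set; the sequence generating that tail serves, since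
  -- all tails of `b r` are listed at the next stage.
  U-stronglyReductible : StronglyReductible F U
  U-stronglyReductible (_ , r , j , ⊆X) = dropSeq j (b r)
    , ⊆X ∘ proj₁ (FR-dropSeq≐Tail j)
    , λ i → (suc r , derived r (tailSet (j + i)) (preimage-cong head (FR≐ i))) , r , j + i , proj₂ (FR≐ i)
    where
    FR≐ : ∀ i → FR F (dropSeq i (dropSeq j (b r))) ≐ Tail F (b r) (j + i)
    FR≐ i = ≐-trans (FR-dropSeq≐Tail i) (Tail-dropSeq⊆ j , ⊆Tail-dropSeq j)

  -- If `U` were principal at `x`, then the singleton of `x` would contain a tail of some `b r`. The
  -- constant sequence `x` would then reduce `a₀` and have a one-element FR.
  U-nonprincipal : (∀ c → c ≤[ F ] a₀ → ¬ (∃[ x ] FR F c ≐ ｛ x ｝)) → ¬ IsPrincipal (unary 𝔄) U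
  U-nonprincipal nondegenerate (x , _ , x∈⇒∈U)
    with x∈⇒∈U {｛ x ｝} ( 𝔄-resp ((λ { refl → refl }) , λ { {_ ∷ []} refl → refl }) (𝔄-singleton (x ∷ []))
                        , refl)
  ... | _ , r , j , ⊆x = nondegenerate (λ _ → x) (≼⇒≤ (constant-≼ x∈a₀)) (x , FR≐)
    where
    x∈b : ∀ l → x ∈ Tail F (b r) l
    -- The entry at `l ⊔ j` lies beyond `j`, so equals `x`, and beyond `l`, so belongs to the
    -- required tail.
    x∈b l = subst (_∈ Tail F (b r) l) (sym (⊆x (Tail-antitone (m≤n⊔m l j) (entry∈Tail (b r) (l ⊔ j)))))
      (Tail-antitone (m≤m⊔n l j) (entry∈Tail (b r) (l ⊔ j)))

    x∈a₀ : ∀ l → x ∈ Tail F a₀ l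
    x∈a₀ l = ≼⇒Tail⊆ (b-≼-a₀ r) (x∈b l)

    constant-≼-b : (λ _ → x) ≼[ F ] dropSeq j (b r)
    -- From index `j` on, every entry of `b r` is `x`.
    constant-≼-b = (λ n → n) , λ n → subst (Value F _ n (suc n))
      (sym (⊆x (Tail-antitone (m≤m+n j n) (entry∈Tail (b r) (j + n))))) (entry ≤-refl ≤-refl)

    FR≐ : FR F (λ _ → x) ≐ ｛ x ｝
    FR≐ = (λ y∈FR → ⊆x (proj₁ (FR-dropSeq≐Tail j) (Tail⇒FR (≼⇒Tail⊆ constant-≼-b (FR⇒Value y∈FR))))) ,
          λ { refl → Tail⇒FR (entry∈Tail (λ _ → x) 0) }

theorem5p8 : ExcludedMiddle (lsuc 0ℓ) →
    (F : Operations ℕ) →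
    IsNondegenerateRamsey ℕ F →
    Countable (operationSetoid ℕ) F →
    (S : Family) →
    (∀ n → CountableCollection (S (suc n))) →
    Σ Family λ 𝔄 → IsAdmissible 𝔄
    × (∀ n → CountableCollection (𝔄 (suc n)) × S (suc n) ⊆ 𝔄 (suc n))
    × (∀ {k f} → (k , f) ∈ F → Is[ 𝔄 ]-Operation f)
    × Σ (Collection ℕ) λ U → Is[ 𝔄 ]-Ultrafilter U
    × ¬ IsPrincipal (unary 𝔄) U
    × StronglyReductible F U
theorem5p8 em F (ramsey , nondegenerate) F-countable S S-countable =
  𝔄 , 𝔄-admissible
  , (λ n → 𝔄-countable (suc n) , λ X∈S → 0 , proj₂ (enumerate em full (S-countable n)) X∈S)
  , (λ f∈F → 𝔄-operation (proj₂ (proj₂ F-enumerated f∈F)))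
  , U , record { isUltrafilter = U-isUltrafilter ; definable = λ n → U-definable (suc n) }
  , U-nonprincipal (proj₂ nondegenerate-sequence)
  , U-stronglyReductible
  where
  em₀ : ExcludedMiddle 0ℓ
  em₀ {P} = map′ lower lift (em {Lift _ P})

  F-enumerated = enumerate em₀ (0 , head) F-countable

  S-enumerated : Sets
  -- A placeholder: the hypothesis on `S` starts at arity 1.
  S-enumerated zero    k = full
  S-enumerated (suc n) = proj₁ (enumerate em full (S-countable n))

  nondegenerate-sequence : ∃[ a ] ∀ c → c ≤[ F ] a → ¬ (∃[ x ] FR F c ≐ ｛ x ｝)
  -- If there were no such sequence, excluded middle would supply for each `a` a reduction with
  -- one-element FR, making the algebra degenerate.
  nondegenerate-sequence = decidable-stable em₀ λ ∄ →
    nondegenerate λ a → decidable-stable em₀ λ ∄c → ∄ (a , λ c c≤a x → ∄c (c , c≤a , x))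

  open Construction em₀ F ramsey (proj₁ F-enumerated) S-enumerated (proj₁ nondegenerate-sequence)
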